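{- Both of the problems Strong Rainbow Connectivity and Strong Rainbow Vertex Connectivity are solvable in polynomial time when restricted to instances whose input graph is a split graph.
   Context: All graphs are simple, undirected and finite. Vertex-colorings $\psi: V\to C$ and edge-colorings $\zeta: E\to C$ are arbitrary maps to a set of colors $C$ (no properness is required). A shortest path between two vertices is a path of length equal to their distance in the graph. Strong Rainbow Connectivity: the input is a connected undirected graph $H=(V,E)$ and an edge-coloring $\zeta: E\to C$; the question is whether $H$ is strongly rainbow connected under $\zeta$, i.e. whether between every pair of vertices there is a shortest path no two edges of which have the same color. Strong Rainbow Vertex Connectivity: the input is a connected undirected graph $G=(V,E)$ and a vertex-coloring $\psi: V\to C$; the question is whether $G$ is strongly rainbow vertex connected under $\psi$, i.e. whether between every pair of vertices there is a shortest path whose internal vertices have pairwise distinct colors. A split graph is a graph whose vertex set can be partitioned into a clique and an independent set. -}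

module Defs where

open import Data.Bool.Base using (Bool; true; false; T; if_then_else_)
open import Data.Bool.Properties using (T?)
open import Data.Fin.Base using (Fin)
open import Data.Fin.Subset using (Subset; _∈_; _∉_)
open import Data.List.Base
  using (List; []; _∷_; _++_; [_]; concat; drop; length; map; tabulate)
open import Data.List.Relation.Unary.Unique.Propositional using (Unique)
open import Data.Maybe.Base using (Maybe; just; nothing)
open import Data.Nat.Base using (ℕ; zero; suc; _+_; _*_; _∸_; _^_; _≤_; _≡ᵇ_)
open import Data.Nat.ListAction using (sum)
open import Data.Nat.Logarithm using (⌊log₂_⌋)
open import Data.Product.Base using (Σ; ∃-syntax; _×_; proj₁)
open import Data.Sum.Base using (_⊎_; inj₁; inj₂)
open import Relation.Binary.Construct.Closure.ReflexiveTransitive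
  using (Star; ε; _◅_)
open import Relation.Binary.PropositionalEquality using (_≡_; _≢_)
open import Relation.Nullary using (¬_; Reflects; yes; no)

------------------------------------------------------------------------
-- Graphs

record Graph (n : ℕ) : Set where
  field
    adj        : Fin n → Fin n → Bool
    adj-sym    : ∀ u v → adj u v ≡ adj v u
    adj-irrefl : ∀ v → adj v v ≡ false

  infix 4 _~_
  _~_ : Fin n → Fin n → Set
  u ~ v = T (adj u v)

  Walk : Fin n → Fin n → Set
  Walk = Star _~_

module _ {n : ℕ} (G : Graph n) where
  open Graph G

  Connected : Set
  Connected = ∀ u v → Walk u v

  IsSplit : Set
  IsSplit = Σ (Subset n) λ K →
      (∀ u v → u ∈ K → v ∈ K → u ≢ v → u ~ v)
    × (∀ u v → u ∉ K → v ∉ K → ¬ u ~ v)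

-- An edge-colouring assigns a colour to each unordered pair {u , v} of
-- adjacent vertices.

record EdgeColouring {n : ℕ} (G : Graph n) (C : Set) : Set where
  open Graph G
  field
    colour     : ∀ u v → u ~ v → C
    colour-sym : ∀ u v (e : u ~ v) (e′ : v ~ u) → colour u v e ≡ colour v u e′

VertexColouring : {n : ℕ} → Graph n → Set → Set
VertexColouring {n} G C = Fin n → C

module _ {n : ℕ} {G : Graph n} where
  open Graph G

  walkLength : ∀ {u v} → Walk u v → ℕ
  walkLength ε       = 0
  walkLength (_ ◅ p) = suc (walkLength p)

  -- All vertices of a walk but the last, in order.
  sources : ∀ {u v} → Walk u v → List (Fin n)
  sources         ε       = []
  sources {u = u} (_ ◅ p) = u ∷ sources p

  vertices : ∀ {u v} → Walk u v → List (Fin n)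
  vertices {v = v} p = sources p ++ [ v ]

  internalVertices : ∀ {u v} → Walk u v → List (Fin n)
  internalVertices p = drop 1 (sources p)

  IsPath : ∀ {u v} → Walk u v → Set
  IsPath p = Unique (vertices p)

  HasDistance : Fin n → Fin n → ℕ → Set
  HasDistance u v d =
      (∃[ p ] IsPath {u} {v} p × walkLength p ≡ d)
    × (∀ p → IsPath {u} {v} p → d ≤ walkLength p)

  IsShortestPath : ∀ {u v} → Walk u v → Set
  IsShortestPath {u} {v} p = IsPath p × HasDistance u v (walkLength p)

  module _ {C : Set} where

    edgeColours : EdgeColouring G C → ∀ {u v} → Walk u v → List C
    edgeColours ζ ε = []
    edgeColours ζ (_◅_ {i = u} {j = w} e p) =
      EdgeColouring.colour ζ u w e ∷ edgeColours ζ p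

    IsStronglyRainbowConnected : EdgeColouring G C → Set
    IsStronglyRainbowConnected ζ = ∀ u v →
      ∃[ p ] IsShortestPath {u} {v} p × Unique (edgeColours ζ p)

    IsStronglyRainbowVertexConnected : VertexColouring G C → Set
    IsStronglyRainbowVertexConnected ψ = ∀ u v →
      ∃[ p ] IsShortestPath {u} {v} p × Unique (map ψ (internalVertices p))

------------------------------------------------------------------------
-- Random access machines (Cook & Reckhow, "Time bounded random access
-- machines", 1973), with the input placed in memory.  Every instruction
-- costs one step.  There is no multiplication: apart from writing one of the
-- constants of the program, a step lengthens the largest stored number by at
-- most one bit, so unit-cost time is polynomially equivalent to Turing
-- machine time.

data Instr : Set where
  const : (r c : ℕ) → Instr            -- r := c
  add   : (r s t : ℕ) → Instr          -- r := s + t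
  sub   : (r s t : ℕ) → Instr          -- r := s ∸ t
  load  : (r s : ℕ) → Instr            -- r := memory[s]
  store : (r s : ℕ) → Instr            -- memory[r] := s
  jgtz  : (r ℓ : ℕ) → Instr            -- if r > 0 then goto ℓ
  halt  : (verdict : Bool) → Instr

Program : Set
Program = List Instr

record Config : Set where
  constructor ⟨_,_,_⟩
  field
    pc        : ℕ
    registers : ℕ → ℕ
    memory    : ℕ → ℕ

infixl 9 _[_≔_]
_[_≔_] : (ℕ → ℕ) → ℕ → ℕ → (ℕ → ℕ)
(f [ i ≔ x ]) j = if j ≡ᵇ i then x else f j

-- Running off the end of the program rejects.
fetch : Program → ℕ → Instr
fetch []       _       = halt false
fetch (i ∷ is) zero    = i
fetch (i ∷ is) (suc k) = fetch is k

execute : Instr → Config → Config ⊎ Bool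
execute (const r c) ⟨ k , R , M ⟩ = inj₁ ⟨ suc k , R [ r ≔ c ] , M ⟩
execute (add r s t) ⟨ k , R , M ⟩ = inj₁ ⟨ suc k , R [ r ≔ R s + R t ] , M ⟩
execute (sub r s t) ⟨ k , R , M ⟩ = inj₁ ⟨ suc k , R [ r ≔ R s ∸ R t ] , M ⟩
execute (load r s)  ⟨ k , R , M ⟩ = inj₁ ⟨ suc k , R [ r ≔ M (R s) ] , M ⟩
execute (store r s) ⟨ k , R , M ⟩ = inj₁ ⟨ suc k , R , M [ R r ≔ R s ] ⟩
execute (jgtz r ℓ)  ⟨ k , R , M ⟩ with R r
... | zero  = inj₁ ⟨ suc k , R , M ⟩
... | suc _ = inj₁ ⟨ ℓ , R , M ⟩
execute (halt b)    _             = inj₂ b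

step : Program → Config → Config ⊎ Bool
step P c = execute (fetch P (Config.pc c)) c

mutual

  -- run P t c is the verdict of P started from c, if it halts within t steps.
  run : Program → ℕ → Config → Maybe Bool
  run P zero    c = nothing
  run P (suc t) c = continue P t (step P c)

  continue : Program → ℕ → Config ⊎ Bool → Maybe Bool
  continue P t (inj₁ c) = run P t c
  continue P t (inj₂ b) = just b

contents : List ℕ → ℕ → ℕ
contents []       _       = 0
contents (w ∷ ws) zero    = w
contents (w ∷ ws) (suc i) = contents ws i

-- The input occupies an initial segment of memory; register 0 holds its
-- length.
initial : List ℕ → Config
initial ws = ⟨ 0 , (λ _ → 0) [ 0 ≔ length ws ] , contents ws ⟩

bits : ℕ → ℕ
bits w = suc ⌊log₂ w ⌋

size : List ℕ → ℕ
size ws = sum (map bits ws)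

------------------------------------------------------------------------
-- Decision problems

record DecisionProblem : Set₁ where
  field
    Instance : Set
    Yes      : Instance → Set
    encode   : Instance → List ℕ

infixl 5 _restrictedTo_
_restrictedTo_ : (Π : DecisionProblem) →
                 (DecisionProblem.Instance Π → Set) → DecisionProblem
Π restrictedTo P = record
  { Instance = Σ Instance P
  ; Yes      = λ I → Yes (proj₁ I)
  ; encode   = λ I → encode (proj₁ I)
  } where open DecisionProblem Π

SolvableInPolynomialTime : DecisionProblem → Set
SolvableInPolynomialTime Π =
  Σ Program λ P → ∃[ c ] ∃[ k ] ∀ (I : Instance) →
    ∃[ t ] ∃[ b ]
        t ≤ c * size (encode I) ^ k + c
      × run P t (initial (encode I)) ≡ just b
      × Reflects (Yes I) b
  where open DecisionProblem Π

------------------------------------------------------------------------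
-- The two problems.  Colours are named by natural numbers of arbitrary
-- magnitude, each of which contributes its binary length to the input size.

record EdgeColouredInstance : Set where
  field
    {order}   : ℕ
    graph     : Graph order
    connected : Connected graph
    colouring : EdgeColouring graph ℕ

record VertexColouredInstance : Set where
  field
    {order}   : ℕ
    graph     : Graph order
    connected : Connected graph
    colouring : VertexColouring graph ℕ

-- Row by row.
matrix : ∀ {n} → (Fin n → Fin n → ℕ) → List ℕ
matrix f = concat (tabulate λ u → tabulate λ v → f u v)

encodeGraph : ∀ {n} → Graph n → List ℕ
encodeGraph {n} G = n ∷ matrix λ u v → if Graph.adj G u v then 1 else 0

-- The entries at non-adjacent pairs are padding: adjacency is read off the
-- adjacency matrix.
encodeEdgeColouring : ∀ {n} {G : Graph n} → EdgeColouring G ℕ → List ℕ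
encodeEdgeColouring {n} {G} ζ = matrix entry
  where
  entry : Fin n → Fin n → ℕ
  entry u v with T? (Graph.adj G u v)
  ... | yes e = EdgeColouring.colour ζ u v e
  ... | no  _ = 0

StrongRainbowConnectivity : DecisionProblem
StrongRainbowConnectivity = record
  { Instance = EdgeColouredInstance
  ; Yes      = λ I → IsStronglyRainbowConnected (colouring I)
  ; encode   = λ I → encodeGraph (graph I) ++ encodeEdgeColouring (colouring I)
  } where open EdgeColouredInstance

StrongRainbowVertexConnectivity : DecisionProblem
StrongRainbowVertexConnectivity = record
  { Instance = VertexColouredInstance
  ; Yes      = λ I → IsStronglyRainbowVertexConnected {G = graph I} (colouring I)
  ; encode   = λ I → encodeGraph (graph I) ++ tabulate (colouring I)
  } where open VertexColouredInstance

{-# OPTIONS --safe #-}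

-- A connected split graph has diameter at most 3: an endpoint outside the
-- clique has a neighbour in the clique, and clique vertices are adjacent.  So
-- a pair of vertices has a rainbow shortest path iff a bounded formula about
-- at most two further vertices holds, and it suffices to search all quadruples
-- of vertices.  Such a formula is an arithmetic expression with sums over the
-- vertices, true when positive: disjunction is +, negation is 1 ∸ _, and ∃ is
-- a sum.  Sums compile to counting loops of a random access machine.

module Submission where

open import Defs
open import Data.Bool.Base using (true; false; T; if_then_else_)
open import Data.Bool.Properties using (T?; T-irrelevant)
open import Data.Empty using (⊥-elim)
open import Data.Fin.Base using (Fin; zero; suc; toℕ)
open import Data.Fin.Patterns using (0F; 1F; 2F; 3F)
open import Data.Fin.Properties using (any?; toℕ<n; toℕ-injective) renaming (_≟_ to _≟ᶠ_)
open import Data.Fin.Subset using (_∈_)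
open import Data.Fin.Subset.Properties using (_∈?_)
open import Data.List.Base
  using (List; []; _∷_; _++_; [_]; applyUpTo; concat; length; map; tabulate)
open import Data.List.Properties
  using (++-assoc; ++-identityʳ; applyUpTo-∷ʳ; length-++; length-tabulate)
open import Data.List.Relation.Unary.All using ([]; _∷_)
open import Data.List.Relation.Unary.Unique.Propositional using (Unique; []; _∷_)
open import Data.Nat.Base
open import Data.Nat.ListAction using (sum)
open import Data.Nat.ListAction.Properties using (sum-++)
open import Data.Nat.Properties
open import Data.Maybe.Base using (just)
open import Data.Product.Base using (Σ; ∃-syntax; _×_; _,_; proj₁; proj₂)
open import Data.Sum.Base using (_⊎_; inj₁; inj₂)
open import Data.Unit.Base using (⊤; tt)
open import Data.Vec.Base using (Vec; []; _∷_; lookup)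
open import Function.Base using (_∘_)
open import Function.Bundles using (_⇔_; mk⇔; Equivalence)
open import Relation.Binary.Construct.Closure.ReflexiveTransitive using (ε; _◅_)
open import Relation.Binary.PropositionalEquality hiding ([_])
open import Relation.Nullary
  using (¬_; Dec; yes; no; Reflects; ofʸ; ofⁿ; contradiction; _×-dec_)
open import Relation.Nullary.Decidable using (decidable-stable)

-- Bounded arithmetic expressions

∑< : ℕ → (ℕ → ℕ) → ℕ
∑< n f = sum (applyUpTo f n)

-- The compiled loops count down, so the summand they add first is the last one.
∑<-last : ∀ n f → ∑< (suc n) f ≡ f n + ∑< n f
∑<-last n f = begin
  ∑< (suc n) f                       ≡⟨ cong sum (applyUpTo-∷ʳ f n) ⟨
  sum (applyUpTo f n ++ [ f n ])     ≡⟨ sum-++ (applyUpTo f n) [ f n ] ⟩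
  ∑< n f + (f n + 0)                 ≡⟨ cong (∑< n f +_) (+-identityʳ (f n)) ⟩
  ∑< n f + f n                       ≡⟨ +-comm (∑< n f) (f n) ⟩
  f n + ∑< n f                       ∎
  where open ≡-Reasoning

∑<-const : ∀ n x → ∑< n (λ _ → x) ≡ n * x
∑<-const zero    x = refl
∑<-const (suc n) x = cong (x +_) (∑<-const n x)

infixl 6 _⊕_ _⊖_

data Exp (k : ℕ) : Set where
  lit     : ℕ → Exp k
  var     : Fin k → Exp k
  _⊕_ _⊖_ : Exp k → Exp k → Exp k
  mem     : Exp k → Exp k
  ∑       : Exp (suc k) → Exp k

-- Every sum has the bound M 0, the order of the encoded graph; hence the
-- running time of the compiled code depends on that order alone.
⟦_⟧ : ∀ {k} → Exp k → (ℕ → ℕ) → Vec ℕ k → ℕ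
⟦ lit c ⟧ M ρ = c
⟦ var x ⟧ M ρ = lookup ρ x
⟦ e ⊕ f ⟧ M ρ = ⟦ e ⟧ M ρ + ⟦ f ⟧ M ρ
⟦ e ⊖ f ⟧ M ρ = ⟦ e ⟧ M ρ ∸ ⟦ f ⟧ M ρ
⟦ mem e ⟧ M ρ = M (⟦ e ⟧ M ρ)
⟦ ∑ e ⟧   M ρ = ∑< (M 0) λ i → ⟦ e ⟧ M (i ∷ ρ)

-- Compilation

_▷_ : ∀ {k} → ℕ → (Fin k → ℕ) → Fin (suc k) → ℕ
(r ▷ σ) zero    = r
(r ▷ σ) (suc x) = σ x

-- compile e σ d k is code for address k that leaves the value of e in
-- register d and changes no register below d; variable x is held in
-- register σ x.
compile : ∀ {k} → Exp k → (Fin k → ℕ) → ℕ → ℕ → Program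
compile (lit c) σ d k = const d c ∷ []
compile (var x) σ d k = const d 0 ∷ add d d (σ x) ∷ []
compile (e ⊕ f) σ d k =
  c ++ compile f σ (suc d) (length c + k) ++ add d d (suc d) ∷ []
  where c = compile e σ d k
compile (e ⊖ f) σ d k =
  c ++ compile f σ (suc d) (length c + k) ++ sub d d (suc d) ∷ []
  where c = compile e σ d k
compile (mem e) σ d k = compile e σ d k ++ load d d ∷ []
compile (∑ e)   σ d k =
  const d 0 ∷
  const (1 + d) 0 ∷
  load (1 + d) (1 + d) ∷
  const (2 + d) 1 ∷
  -- Since `2 + d` holds 1, this jumps unconditionally to the test at the end; a bound of zero thus
  -- runs no round. Register `d` accumulates, `1 + d` is at once the counter and the bound variable,
  -- and `2 + d` is scratch space that also receives the value of the body.
  jgtz (2 + d) (suc (length body + (7 + k))) ∷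
  const (2 + d) 1 ∷
  sub (1 + d) (1 + d) (2 + d) ∷
  body ++
  add d d (2 + d) ∷
  jgtz (1 + d) (5 + k) ∷ []
  where body = compile e ((1 + d) ▷ σ) (2 + d) (7 + k)

-- Counted from the test. A failed test takes one step; a round takes the jump, two instructions for
-- the decrement, the body and the accumulation.
loopCost : ℕ → ℕ → ℕ
loopCost c zero    = 1
loopCost c (suc m) = 3 + (c + suc (loopCost c m))

cost : ∀ {k} → Exp k → ℕ → ℕ
cost (lit c) n = 1
cost (var x) n = 2
cost (e ⊕ f) n = cost e n + (cost f n + 1)
cost (e ⊖ f) n = cost e n + (cost f n + 1)
cost (mem e) n = cost e n + 1
cost (∑ e)   n = 5 + loopCost (cost e n) n

-- Correctness of the compiled code

≔-same : ∀ R i x → (R [ i ≔ x ]) i ≡ x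
≔-same R i x with i ≡ᵇ i in eq
... | true  = refl
... | false = ⊥-elim (subst T eq (≡⇒≡ᵇ i i refl))

≔-other : ∀ R {i j} x → j ≢ i → (R [ i ≔ x ]) j ≡ R j
≔-other R {i} {j} x j≢i with j ≡ᵇ i in eq
... | false = refl
... | true  = contradiction (≡ᵇ⇒≡ j i (subst T (sym eq) _)) j≢i

≔-below : ∀ R {i j} x → j < i → (R [ i ≔ x ]) j ≡ R j
≔-below R x j<i = ≔-other R x (<⇒≢ j<i)

module _ (P : Program) where

  -- Code k is l: the instructions is occupy the addresses from k up to,
  -- and excluding, l.
  data Code : ℕ → List Instr → ℕ → Set where
    []  : ∀ {k} → Code k [] k
    _∷_ : ∀ {k i is l} → fetch P k ≡ i → Code (suc k) is l → Code k (i ∷ is) l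

  code-++⁻ : ∀ {k l ys} xs → Code k (xs ++ ys) l →
             Code k xs (length xs + k) × Code (length xs + k) ys l
  code-++⁻ []       c       = [] , c
  code-++⁻ {k} {l} {ys} (x ∷ xs) (p ∷ c) with code-++⁻ xs c
  ... | c₁ , c₂ =
    p ∷ subst (Code (suc k) xs) (+-suc (length xs) k) c₁ ,
    subst (λ m → Code m ys l) (+-suc (length xs) k) c₂

  infix 4 _⟶⟨_⟩_
  -- Quantifying over the remaining time `s` lets runs be chained by associativity of `+`. The
  -- record keeps both configurations and the time inferable.
  record _⟶⟨_⟩_ (c : Config) (t : ℕ) (c′ : Config) : Set where
    constructor reaches
    field
      run-reaches : ∀ s → run P (t + s) c ≡ run P s c′
  open _⟶⟨_⟩_ public

  done : ∀ {c} → c ⟶⟨ 0 ⟩ c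
  done = reaches λ _ → refl

  infixr 5 _then_ _⨾_
  _then_ : ∀ {c c′ c″ t} → step P c ≡ inj₁ c′ → c′ ⟶⟨ t ⟩ c″ → c ⟶⟨ suc t ⟩ c″
  _then_ {t = t} p (reaches q) = reaches λ s →
    trans (cong (continue P (t + s)) p) (q s)

  _⨾_ : ∀ {c c′ c″ t t′} → c ⟶⟨ t ⟩ c′ → c′ ⟶⟨ t′ ⟩ c″ → c ⟶⟨ t + t′ ⟩ c″
  _⨾_ {c} {t = t} {t′} (reaches p) (reaches q) = reaches λ s →
    trans (cong (λ m → run P m c) (+-assoc t t′ s)) (trans (p (t′ + s)) (q s))

  exec : ∀ {i k R M c} → fetch P k ≡ i → execute i ⟨ k , R , M ⟩ ≡ inj₁ c →
         step P ⟨ k , R , M ⟩ ≡ inj₁ c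
  exec {k = k} {R} {M} p q = trans (cong (λ i → execute i ⟨ k , R , M ⟩) p) q

  exec-jump : ∀ {r l k R M m} → fetch P k ≡ jgtz r l → R r ≡ suc m →
              step P ⟨ k , R , M ⟩ ≡ inj₁ ⟨ l , R , M ⟩
  exec-jump {r} {l} {k} {R} {M} p q = exec p jump
    where
    jump : execute (jgtz r l) ⟨ k , R , M ⟩ ≡ inj₁ ⟨ l , R , M ⟩
    jump rewrite q = refl

  exec-fall : ∀ {r l k R M} → fetch P k ≡ jgtz r l → R r ≡ 0 →
              step P ⟨ k , R , M ⟩ ≡ inj₁ ⟨ suc k , R , M ⟩
  exec-fall {r} {l} {k} {R} {M} p q = exec p fall
    where
    fall : execute (jgtz r l) ⟨ k , R , M ⟩ ≡ inj₁ ⟨ suc k , R , M ⟩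
    fall rewrite q = refl

  exec-halt : ∀ {k R M b} → fetch P k ≡ halt b → run P 1 ⟨ k , R , M ⟩ ≡ just b
  exec-halt {k} {R} {M} p = cong (λ i → continue P 0 (execute i ⟨ k , R , M ⟩)) p

  module _ (M : ℕ → ℕ) where

    -- The memory is the same `M` at both ends because compiled code contains no `store`. The field
    -- `frame` protects what lower registers hold: loop counters and the left operands of pending
    -- operations.
    record Computes (k : ℕ) (R : ℕ → ℕ) (t l d v : ℕ) : Set where
      field
        final  : ℕ → ℕ
        steps  : ⟨ k , R , M ⟩ ⟶⟨ t ⟩ ⟨ l , final , M ⟩
        result : final d ≡ v
        frame  : ∀ {j} → j < d → final j ≡ R j

    open Computes

    -- The right operand is computed in `suc d`, so its frame condition preserves the left one in
    -- `d`. It starts from the registers that the left operand leaves behind, which are known only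
    -- below `d`; hence the quantification over `R′`.
    binary : ∀ (_∙_ : ℕ → ℕ → ℕ) {i k l m R t t′ d x y} → fetch P m ≡ i →
      (∀ R → execute i ⟨ m , R , M ⟩ ≡ inj₁ ⟨ suc m , R [ d ≔ R d ∙ R (suc d) ] , M ⟩) →
      Computes k R t l d x →
      (∀ {R′} → (∀ {j} → j < d → R′ j ≡ R j) → Computes l R′ t′ m (suc d) y) →
      Computes k R (t + (t′ + 1)) (suc m) d (x ∙ y)
    binary _∙_ {d = d} p i≡∙ C D = record
      { final  = final D′ [ d ≔ _ ]
      ; steps  = steps C ⨾ steps D′ ⨾ exec p (i≡∙ (final D′)) then done
      ; result = trans (≔-same (final D′) d _)
          (cong₂ _∙_ (trans (frame D′ ≤-refl) (result C)) (result D′))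
      ; frame  = λ j<d → trans (≔-below (final D′) _ j<d)
                         (trans (frame D′ (m<n⇒m<1+n j<d)) (frame C j<d))
      }
      where D′ = D (frame C)

    -- Induction on `e`. As `σ x < d`, every variable sits in a register covered by the frame
    -- condition, so the hypothesis on `R` is still available when a later subexpression starts.
    compile-correct : ∀ {k} (e : Exp k) {σ ρ d p l R} →
      Code p (compile e σ d p) l →
      (∀ x → σ x < d) → (∀ x → R (σ x) ≡ lookup ρ x) →
      Computes p R (cost e (M 0)) l d (⟦ e ⟧ M ρ)
    compile-correct (lit c) {d = d} {R = R} (p ∷ []) _ _ = record
      { final  = R [ d ≔ c ]
      ; steps  = exec p refl then done
      ; result = ≔-same R d c
      ; frame  = ≔-below R c
      }
    compile-correct (var x) {σ} {ρ} {d} {R = R} (p ∷ q ∷ []) σ<d σ≡ρ = record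
      { final  = R₁ [ d ≔ R₁ d + R₁ (σ x) ]
      ; steps  = exec p refl then exec q refl then done
      ; result = trans (≔-same R₁ d _)
          (cong₂ _+_ (≔-same R d 0) (trans (≔-below R 0 (σ<d x)) (σ≡ρ x)))
      ; frame  = λ j<d → trans (≔-below R₁ _ j<d) (≔-below R 0 j<d)
      }
      where R₁ = R [ d ≔ 0 ]
    compile-correct (e ⊕ f) {σ} {ρ} {d} {p} c σ<d σ≡ρ
      with c₁ , c′ ← code-++⁻ (compile e σ d p) c
      with c₂ , (q ∷ []) ← code-++⁻ (compile f σ (suc d) _) c′ =
      binary _+_ q (λ _ → refl) (compile-correct e c₁ σ<d σ≡ρ)
             (λ fr → compile-correct f c₂ (λ x → m<n⇒m<1+n (σ<d x))
                       (λ x → trans (fr (σ<d x)) (σ≡ρ x)))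
    compile-correct (e ⊖ f) {σ} {ρ} {d} {p} c σ<d σ≡ρ
      with c₁ , c′ ← code-++⁻ (compile e σ d p) c
      with c₂ , (q ∷ []) ← code-++⁻ (compile f σ (suc d) _) c′ =
      binary _∸_ q (λ _ → refl) (compile-correct e c₁ σ<d σ≡ρ)
             (λ fr → compile-correct f c₂ (λ x → m<n⇒m<1+n (σ<d x))
                       (λ x → trans (fr (σ<d x)) (σ≡ρ x)))
    compile-correct (mem e) {σ} {d = d} {p} c σ<d σ≡ρ
      with c₁ , (q ∷ []) ← code-++⁻ (compile e σ d p) c = record
      { final  = final C [ d ≔ M (final C d) ]
      ; steps  = steps C ⨾ exec q refl then done
      ; result = trans (≔-same (final C) d _) (cong M (result C))
      ; frame  = λ j<d → trans (≔-below (final C) _ j<d) (frame C j<d)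
      }
      where C = compile-correct e c₁ σ<d σ≡ρ
    compile-correct (∑ e) {σ} {ρ} {d} {p} {l} {R}
      (p₀ ∷ p₁ ∷ p₂ ∷ p₃ ∷ p₄ ∷ p₅ ∷ p₆ ∷ c) σ<d σ≡ρ
      with c₁ , (p₇ ∷ p₈ ∷ []) ← code-++⁻ (compile e ((1 + d) ▷ σ) (2 + d) (7 + p)) c = record
      { final  = final L
      ; steps  = exec p₀ refl then exec p₁ refl then exec p₂ refl then exec p₃ refl then
                 exec-jump p₄ (≔-same R₃ (2 + d) 1) then steps L
      ; result = trans (result L)
          (cong (_+ ⟦ ∑ e ⟧ M ρ) (trans (above d<1+d) (≔-same R d 0)))
      ; frame  = λ j<d → trans (frame L j<d) (below j<d)
      }
      where
      σ′ = (1 + d) ▷ σ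
      test = suc (length (compile e σ′ (2 + d) (7 + p)) + (7 + p))
      f = λ i → ⟦ e ⟧ M (i ∷ ρ)
      d<1+d = n<1+n d
      1+d<2+d = n<1+n (1 + d)
      d<2+d = m<n⇒m<1+n d<1+d

      σ′<2+d : ∀ x → σ′ x < 2 + d
      σ′<2+d zero    = 1+d<2+d
      σ′<2+d (suc x) = m<n⇒m<1+n (m<n⇒m<1+n (σ<d x))

      -- Induction on the counter, from the test onwards and with an arbitrary accumulator. A round
      -- decrements before it evaluates the body, so counter `suc m` yields the summand at index
      -- `m`, as in `∑<-last`.
      loop : ∀ m {R} → R (1 + d) ≡ m → (∀ x → R (σ x) ≡ lookup ρ x) →
             Computes test R (loopCost (cost e (M 0)) m) l d (R d + ∑< m f)
      loop zero {R} R≡m _ = record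
        { final  = R
        ; steps  = exec-fall p₈ R≡m then done
        ; result = sym (+-identityʳ (R d))
        ; frame  = λ _ → refl
        }
      loop (suc m) {R} R≡m σ≡ρ = record
        { final  = final L
        ; steps  = exec-jump p₈ R≡m then exec p₅ refl then exec p₆ refl then
                   steps C ⨾ exec p₇ refl then steps L
        ; result = trans (result L) (begin
            R₃ d + ∑< m f           ≡⟨ cong (_+ ∑< m f) (≔-same (final C) d _) ⟩
            final C d + final C (2 + d) + ∑< m f
              ≡⟨ cong (_+ ∑< m f) (cong₂ _+_ (trans (frame C d<2+d) (below d<1+d)) (result C)) ⟩
            R d + f m + ∑< m f      ≡⟨ +-assoc (R d) (f m) (∑< m f) ⟩
            R d + (f m + ∑< m f)    ≡⟨ cong (R d +_) (∑<-last m f) ⟨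
            R d + ∑< (suc m) f      ∎)
        ; frame  = λ j<d → trans (frame L j<d) (below₃ j<d)
        }
        where
        open ≡-Reasoning
        R₁ = R [ 2 + d ≔ 1 ]
        R₂ = R₁ [ 1 + d ≔ R₁ (1 + d) ∸ R₁ (2 + d) ]

        below : ∀ {j} → j < 1 + d → R₂ j ≡ R j
        below j<1+d = trans (≔-below R₁ _ j<1+d) (≔-below R 1 (m<n⇒m<1+n j<1+d))

        index : R₂ (1 + d) ≡ m
        index = trans (≔-same R₁ (1 + d) _)
          (cong₂ _∸_ (trans (≔-below R 1 1+d<2+d) R≡m) (≔-same R (2 + d) 1))

        σ′≡ρ : ∀ x → R₂ (σ′ x) ≡ lookup (m ∷ ρ) x
        σ′≡ρ zero    = index
        σ′≡ρ (suc x) = trans (below (m<n⇒m<1+n (σ<d x))) (σ≡ρ x)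

        C = compile-correct e c₁ σ′<2+d σ′≡ρ
        R₃ = final C [ d ≔ final C d + final C (2 + d) ]

        below₃ : ∀ {j} → j < d → R₃ j ≡ R j
        below₃ j<d = trans (≔-below (final C) _ j<d)
          (trans (frame C (m<n⇒m<1+n (m<n⇒m<1+n j<d))) (below (m<n⇒m<1+n j<d)))

        L = loop m {R₃}
          (trans (≔-other (final C) _ (1+n≢n)) (trans (frame C 1+d<2+d) index))
          (λ x → trans (below₃ (σ<d x)) (σ≡ρ x))

      R₁ = R [ d ≔ 0 ]
      R₂ = R₁ [ 1 + d ≔ 0 ]
      R₃ = R₂ [ 1 + d ≔ M (R₂ (1 + d)) ]
      R₄ = R₃ [ 2 + d ≔ 1 ]

      above : ∀ {j} → j < 1 + d → R₄ j ≡ R₁ j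
      above j<1+d = trans (≔-below R₃ 1 (m<n⇒m<1+n j<1+d))
        (trans (≔-below R₂ _ j<1+d) (≔-below R₁ 0 j<1+d))

      below : ∀ {j} → j < d → R₄ j ≡ R j
      below j<d = trans (above (m<n⇒m<1+n j<d)) (≔-below R 0 j<d)

      L = loop (M 0) {R₄}
        (trans (≔-below R₃ 1 1+d<2+d)
          (trans (≔-same R₂ (1 + d) _) (cong M (≔-same R₁ (1 + d) 0))))
        (λ x → trans (below (σ<d x)) (σ≡ρ x))

code-shift : ∀ {P k is l} x → Code P k is l → Code (x ∷ P) (suc k) is (suc l)
code-shift x []      = []
code-shift x (p ∷ c) = p ∷ code-shift x c

code-self : ∀ P → Code P 0 P (length P)
code-self []      = []
code-self (x ∷ P) = refl ∷ code-shift x (code-self P)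

-- Running time

-- The bound is in terms of any `N` above `n`, later the input size, so that no monotonicity of `f`
-- has to be proved. With `1 ≤ N`, powers of `N` grow with the exponent and a single monomial
-- suffices.
PolynomiallyBounded : (ℕ → ℕ) → Set
PolynomiallyBounded f =
  ∃[ c ] ∃[ k ] ∀ {n N} → n ≤ N → 1 ≤ N → f n ≤ c * N ^ k

const-bounded : ∀ c → PolynomiallyBounded λ _ → c
const-bounded c = c , 0 , λ _ _ → ≤-reflexive (sym (*-identityʳ c))

+-bounded : ∀ {f g} → PolynomiallyBounded f → PolynomiallyBounded g →
            PolynomiallyBounded λ n → f n + g n
+-bounded {f} {g} (c , k , f≤) (d , l , g≤) = c + d , k + l , bound
  where
  bound : ∀ {n N} → n ≤ N → 1 ≤ N → f n + g n ≤ (c + d) * N ^ (k + l)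
  bound {n} {N} n≤N 1≤N = begin
    f n + g n                              ≤⟨ +-mono-≤ (f≤ n≤N 1≤N) (g≤ n≤N 1≤N) ⟩
    c * N ^ k + d * N ^ l                  ≤⟨ +-mono-≤
      (*-monoʳ-≤ c (^-monoʳ-≤ N (m≤m+n k l)))
      (*-monoʳ-≤ d (^-monoʳ-≤ N (m≤n+m l k))) ⟩
    c * N ^ (k + l) + d * N ^ (k + l)      ≡⟨ *-distribʳ-+ (N ^ (k + l)) c d ⟨
    (c + d) * N ^ (k + l)                  ∎
    where
    open ≤-Reasoning
    instance
      N≢0 : NonZero N
      N≢0 = >-nonZero 1≤N

id*-bounded : ∀ {f} → PolynomiallyBounded f → PolynomiallyBounded λ n → n * f n
id*-bounded {f} (c , k , f≤) = c , suc k , bound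
  where
  bound : ∀ {n N} → n ≤ N → 1 ≤ N → n * f n ≤ c * N ^ suc k
  bound {n} {N} n≤N 1≤N = begin
    n * f n          ≤⟨ *-mono-≤ n≤N (f≤ n≤N 1≤N) ⟩
    N * (c * N ^ k)  ≡⟨ *-assoc N c (N ^ k) ⟨
    N * c * N ^ k    ≡⟨ cong (_* N ^ k) (*-comm N c) ⟩
    c * N * N ^ k    ≡⟨ *-assoc c N (N ^ k) ⟩
    c * N ^ suc k    ∎
    where open ≤-Reasoning

≗-bounded : ∀ {f g} → f ≗ g → PolynomiallyBounded g → PolynomiallyBounded f
≗-bounded f≗g (c , k , g≤) =
  c , k , λ {n} n≤N 1≤N → ≤-trans (≤-reflexive (f≗g n)) (g≤ n≤N 1≤N)

loopCost≡ : ∀ c m → loopCost c m ≡ m * (4 + c) + 1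
loopCost≡ c zero    = refl
loopCost≡ c (suc m) = begin
  3 + (c + suc (loopCost c m))      ≡⟨ cong (3 +_) (+-suc c (loopCost c m)) ⟩
  4 + (c + loopCost c m)            ≡⟨ cong (λ l → 4 + (c + l)) (loopCost≡ c m) ⟩
  4 + (c + (m * (4 + c) + 1))       ≡⟨ cong (4 +_) (+-assoc c (m * (4 + c)) 1) ⟨
  suc m * (4 + c) + 1               ∎
  where open ≡-Reasoning

cost-bounded : ∀ {k} (e : Exp k) → PolynomiallyBounded (cost e)
cost-bounded (lit c) = const-bounded 1
cost-bounded (var x) = const-bounded 2
cost-bounded (e ⊕ f) =
  +-bounded (cost-bounded e) (+-bounded (cost-bounded f) (const-bounded 1))
cost-bounded (e ⊖ f) =
  +-bounded (cost-bounded e) (+-bounded (cost-bounded f) (const-bounded 1))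
cost-bounded (mem e) = +-bounded (cost-bounded e) (const-bounded 1)
cost-bounded (∑ e)   = ≗-bounded (λ n → cong (5 +_) (loopCost≡ (cost e n) n))
  (+-bounded (const-bounded 5)
    (+-bounded (id*-bounded (+-bounded (const-bounded 4) (cost-bounded e)))
               (const-bounded 1)))

-- Deciding by the sign of an expression

data Decides (P : Set) : ℕ → Set where
  holds : ∀ {x} → P → Decides P (suc x)
  fails : ¬ P → Decides P 0

noVariables : Fin 0 → ℕ
noVariables ()

-- Word 0 of the input bounds every loop, so the running time is polynomial in that word. The second
-- hypothesis turns this into a polynomial in the input size and also makes the size positive.
solvable-by-expression :
  (Π : DecisionProblem) → let open DecisionProblem Π in
  (e : Exp 0) →
  (∀ I → contents (encode I) 0 < size (encode I)) →
  (∀ I → Decides (Yes I) (⟦ e ⟧ (contents (encode I)) [])) →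
  SolvableInPolynomialTime Π
solvable-by-expression Π e small decides = P , c , k , λ I →
  let b , runs , reflects = verdict I
      bound = cost≤ (<⇒≤ (small I)) (≤-trans (s≤s z≤n) (small I))
  in cost e (contents (encode I) 0) + 2 , b , ≤-trans bound (m≤m+n _ c) , runs , reflects
  where
  open DecisionProblem Π
  bounded = +-bounded (cost-bounded e) (const-bounded 2)
  c = proj₁ bounded
  k = proj₁ (proj₂ bounded)
  cost≤ = proj₂ (proj₂ bounded)
  code = compile e noVariables 0 0
  -- A positive value in register 0 jumps to `halt true`; zero falls through to `halt false`. Either
  -- way two more steps are taken.
  P = code ++ jgtz 0 (2 + (length code + 0)) ∷ halt false ∷ halt true ∷ []

  verdict : ∀ I → ∃[ b ]
    run P (cost e (contents (encode I) 0) + 2) (initial (encode I)) ≡ just b ×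
    Reflects (Yes I) b
  verdict I with code-++⁻ P code (code-self P)
  ... | p , (q₀ ∷ q₁ ∷ q₂ ∷ _) = conclude (decides I) result
    where
    M = contents (encode I)
    open Computes (compile-correct P M e {ρ = []} p (λ ()) (λ ()))

    conclude : ∀ {v} → Decides (Yes I) v → final 0 ≡ v → ∃[ b ]
      run P (cost e (M 0) + 2) (initial (encode I)) ≡ just b × Reflects (Yes I) b
    conclude (holds y) ≡v = true , trans (run-reaches steps 2)
      (trans (run-reaches (_then_ P (exec-jump P q₀ ≡v) (done P)) 1)
             (exec-halt P q₂)) , ofʸ y
    conclude (fails ¬y) ≡v = false , trans (run-reaches steps 2)
      (trans (run-reaches (_then_ P (exec-fall P q₀ ≡v) (done P)) 1)
             (exec-halt P q₁)) , ofⁿ ¬y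

map-decides : ∀ {P Q x} → P ⇔ Q → Decides P x → Decides Q x
map-decides P⇔Q (holds p)  = holds (Equivalence.to P⇔Q p)
map-decides P⇔Q (fails ¬p) = fails (¬p ∘ Equivalence.from P⇔Q)

-- Logical connectives as arithmetic

infixr 6 _∧_
infixr 5 _∨_
infix 7 _≠_ _≐_

_∨_ _∧_ _≠_ _≐_ : ∀ {k} → Exp k → Exp k → Exp k
not : ∀ {k} → Exp k → Exp k
all : ∀ {k} → Exp (suc k) → Exp k

not e = lit 1 ⊖ e
e ∨ f = e ⊕ f
e ∧ f = not (not e ⊕ not f)
e ≠ f = (e ⊖ f) ⊕ (f ⊖ e)
e ≐ f = not (e ≠ f)
all e = not (∑ (not e))

-- Justifies constructively the De Morgan definitions of `_∧_` and `all`, as well as `_≐_`.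
stable : ∀ {P x} → Decides P x → ¬ ¬ P → P
stable (holds p)  _   = p
stable (fails ¬p) ¬¬p = contradiction ¬p ¬¬p

decides-¬ : ∀ {P x} → Decides P x → Decides (¬ P) (1 ∸ x)
-- `1 ∸ suc x` computes only as far as `0 ∸ x`, which is stuck on `x`.
decides-¬ (holds {x} p) rewrite 0∸n≡0 x = fails λ ¬p → ¬p p
decides-¬ (fails ¬p) = holds ¬p

decides-⊎ : ∀ {P Q x y} → Decides P x → Decides Q y → Decides (P ⊎ Q) (x + y)
decides-⊎ (holds p)  _          = holds (inj₁ p)
decides-⊎ (fails ¬p) (holds q)  = holds (inj₂ q)
decides-⊎ (fails ¬p) (fails ¬q) = fails λ where
  (inj₁ p) → ¬p p
  (inj₂ q) → ¬q q

decides-× : ∀ {P Q x y} → Decides P x → Decides Q y →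
            Decides (P × Q) (1 ∸ ((1 ∸ x) + (1 ∸ y)))
decides-× p? q? = map-decides
  (mk⇔ (λ ¬⊎ → stable p? (¬⊎ ∘ inj₁) , stable q? (¬⊎ ∘ inj₂))
       (λ where (p , q) (inj₁ ¬p) → ¬p p
                (p , q) (inj₂ ¬q) → ¬q q))
  (decides-¬ (decides-⊎ (decides-¬ p?) (decides-¬ q?)))

decides-≢ : ∀ x y → Decides (x ≢ y) ((x ∸ y) + (y ∸ x))
decides-≢ zero    zero    = fails λ x≢y → x≢y refl
decides-≢ zero    (suc y) = holds λ ()
decides-≢ (suc x) zero    = holds λ ()
decides-≢ (suc x) (suc y) = map-decides
  (mk⇔ (λ x≢y → x≢y ∘ suc-injective) (λ x≢y → x≢y ∘ cong suc)) (decides-≢ x y)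

decides-≡ : ∀ x y → Decides (x ≡ y) (1 ∸ ((x ∸ y) + (y ∸ x)))
decides-≡ x y = map-decides
  (mk⇔ (decidable-stable (x ≟ y)) (λ x≡y x≢y → x≢y x≡y)) (decides-¬ (decides-≢ x y))

decides-∃ : ∀ n (f : ℕ → ℕ) {P : Fin n → Set} → (∀ i → Decides (P i) (f (toℕ i))) →
            Decides (∃[ i ] P i) (∑< n f)
decides-∃ zero    f P? = fails λ ()
decides-∃ (suc n) f P? = map-decides
  (mk⇔ (λ where (inj₁ p)       → zero , p
                (inj₂ (i , p)) → suc i , p)
       (λ where (zero , p)  → inj₁ p
                (suc i , p) → inj₂ (i , p)))
  (decides-⊎ (P? zero) (decides-∃ n (f ∘ suc) (P? ∘ suc)))

decides-∀ : ∀ n (f : ℕ → ℕ) {P : Fin n → Set} → (∀ i → Decides (P i) (f (toℕ i))) →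
            Decides (∀ i → P i) (1 ∸ ∑< n λ i → 1 ∸ f i)
decides-∀ n f P? = map-decides
  (mk⇔ (λ ¬∃¬ i → stable (P? i) (λ ¬p → ¬∃¬ (i , ¬p))) (λ ∀p (i , ¬p) → ¬p (∀p i)))
  (decides-¬ (decides-∃ n (λ i → 1 ∸ f i) (λ i → decides-¬ (P? i))))

-- Shortest paths in split graphs

module _ {n : ℕ} (G : Graph n) where
  open Graph G

  ~-sym : ∀ {u v} → u ~ v → v ~ u
  ~-sym {u} {v} = subst T (adj-sym u v)

  ~⇒≢ : ∀ {u v} → u ~ v → u ≢ v
  ~⇒≢ {u} e refl = subst T (adj-irrefl u) e

  Joined : Fin n → Fin n → Set
  Joined u v = ∃[ w ] u ~ w × w ~ v

  joined? : ∀ u v → Dec (Joined u v)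
  joined? u v = any? λ w → T? (adj u w) ×-dec T? (adj w v)

  -- `HasDistance` compares with paths only. Comparing with all walks lets the lower bounds below
  -- look at nothing but the first few constructors of the competitor.
  shortest : ∀ {u v} (p : Walk u v) → IsPath {G = G} p →
             (∀ q → walkLength {G = G} p ≤ walkLength {G = G} {u} {v} q) →
             IsShortestPath {G = G} p
  shortest p path p≤ = path , (p , path , refl) , λ q _ → p≤ q

  shortest₀ : ∀ {u} → IsShortestPath {G = G} {u} ε
  shortest₀ = shortest ε ([] ∷ []) λ _ → z≤n

  shortest₁ : ∀ {u v} (e : u ~ v) → IsShortestPath {G = G} (e ◅ ε)
  shortest₁ {u} {v} e = shortest (e ◅ ε) ((~⇒≢ e ∷ []) ∷ [] ∷ []) longer
    where
    longer : ∀ q → 1 ≤ walkLength {G = G} {u} {v} q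
    longer ε       = contradiction refl (~⇒≢ e)
    longer (_ ◅ _) = s≤s z≤n

  shortest₂ : ∀ {u w v} → u ≢ v → ¬ u ~ v → (e : u ~ w) (f : w ~ v) →
              IsShortestPath {G = G} (e ◅ f ◅ ε)
  shortest₂ {u} {_} {v} u≢v u≁v e f =
    shortest (e ◅ f ◅ ε) ((~⇒≢ e ∷ u≢v ∷ []) ∷ (~⇒≢ f ∷ []) ∷ [] ∷ []) longer
    where
    longer : ∀ q → 2 ≤ walkLength {G = G} {u} {v} q
    longer ε           = contradiction refl u≢v
    longer (g ◅ ε)     = contradiction g u≁v
    longer (_ ◅ _ ◅ _) = s≤s (s≤s z≤n)

  shortest₃ : ∀ {u w x v} → u ≢ v → ¬ u ~ v → ¬ Joined u v →
              (e : u ~ w) (f : w ~ x) (g : x ~ v) → IsShortestPath {G = G} (e ◅ f ◅ g ◅ ε)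
  shortest₃ {u} {v = v} u≢v u≁v ¬j e f g = shortest (e ◅ f ◅ g ◅ ε)
    -- If the third vertex were `u`, or the second were `v`, then `u` and `v` would be adjacent.
    ( (~⇒≢ e ∷ (λ { refl → u≁v g }) ∷ u≢v ∷ [])
    ∷ (~⇒≢ f ∷ (λ { refl → u≁v e }) ∷ [])
    ∷ (~⇒≢ g ∷ []) ∷ [] ∷ []) longer
    where
    longer : ∀ q → 3 ≤ walkLength {G = G} {u} {v} q
    longer ε               = contradiction refl u≢v
    longer (h ◅ ε)         = contradiction h u≁v
    longer (h ◅ i ◅ ε)     = contradiction (_ , h , i) ¬j
    longer (_ ◅ _ ◅ _ ◅ _) = s≤s (s≤s (s≤s z≤n))

  neighbour : Connected G → ∀ {u v} → u ≢ v → ∃[ w ] u ~ w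
  neighbour conn {u} {v} u≢v with conn u v
  ... | ε     = contradiction refl u≢v
  ... | e ◅ _ = _ , e

  -- An end of the path outside the clique is replaced by a neighbour, which
  -- lies in the clique; the two clique vertices so obtained are adjacent.
  split-diameter : Connected G → IsSplit G → ∀ {u v} →
    u ≢ v → ¬ u ~ v → ¬ Joined u v → ∃[ w ] ∃[ x ] u ~ w × w ~ x × x ~ v
  split-diameter conn (K , clique , independent) {u} {v} u≢v u≁v ¬j =
    attach (u ∈? K) (v ∈? K) (neighbour conn u≢v) (neighbour conn (u≢v ∘ sym))
    where
    enters : ∀ {a b} → ¬ a ∈ K → a ~ b → b ∈ K
    enters {a} {b} a∉K e = decidable-stable (b ∈? K) λ b∉K → independent a b a∉K b∉K e

    attach : Dec (u ∈ K) → Dec (v ∈ K) → ∃[ w ] u ~ w → ∃[ x ] v ~ x →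
             ∃[ w ] ∃[ x ] u ~ w × w ~ x × x ~ v
    attach (yes u∈K) (yes v∈K) _ _ = contradiction (clique u v u∈K v∈K u≢v) u≁v
    attach (yes u∈K) (no v∉K) _ (x , f) with u ≟ᶠ x
    ... | yes refl = contradiction (~-sym f) u≁v
    ... | no u≢x   = contradiction (x , clique u x u∈K (enters v∉K f) u≢x , ~-sym f) ¬j
    attach (no u∉K) (yes v∈K) (w , e) _ with w ≟ᶠ v
    ... | yes refl = contradiction e u≁v
    ... | no w≢v   = contradiction (w , e , clique w v (enters u∉K e) v∈K w≢v) ¬j
    attach (no u∉K) (no v∉K) (w , e) (x , f) with w ≟ᶠ x
    ... | yes refl = contradiction (w , e , ~-sym f) ¬j
    ... | no w≢x   = w , x , e , clique w x (enters u∉K e) (enters v∉K f) w≢x , ~-sym f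

  module _ (D₂ : (u w v : Fin n) → Set) (D₃ : (u w x v : Fin n) → Set) where

    -- The disjuncts follow the possible distances 0 to 3, with `D₂` and `D₃` as colour conditions.
    -- The third can do without `u ≢ v` and `¬ u ~ v`, because a pair violating either is good
    -- anyway. The last must exclude common neighbours: a rainbow path of length three says nothing
    -- about a pair at distance two.
    Good : Fin n → Fin n → Set
    Good u v =
        u ≡ v
      ⊎ u ~ v
      ⊎ (∃[ w ] (u ~ w × w ~ v) × D₂ u w v)
      ⊎ ¬ Joined u v × ∃[ w ] ∃[ x ] (u ~ w × w ~ x × x ~ v) × D₃ u w x v

    module _
      (conn : Connected G) (split : IsSplit G)
      (Rainbow : ∀ {u v} → Walk u v → Set)
      (rainbow₀ : ∀ {u} → Rainbow {u} ε)
      (rainbow₁ : ∀ {u v} (e : u ~ v) → Rainbow (e ◅ ε))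
      (rainbow₂ : ∀ {u w v} (e : u ~ w) (f : w ~ v) → Rainbow (e ◅ f ◅ ε) ⇔ D₂ u w v)
      (rainbow₃ : ∀ {u w x v} (e : u ~ w) (f : w ~ x) (g : x ~ v) →
                  Rainbow (e ◅ f ◅ g ◅ ε) ⇔ D₃ u w x v)
      where
      open Equivalence

      good⇔rainbow : ∀ u v → Good u v ⇔ (∃[ p ] IsShortestPath {G = G} {u} {v} p × Rainbow p)
      good⇔rainbow u v with u ≟ᶠ v
      ... | yes refl = mk⇔ (λ _ → ε , shortest₀ , rainbow₀) (λ _ → inj₁ refl)
      ... | no u≢v with T? (adj u v)
      ... | yes e = mk⇔ (λ _ → e ◅ ε , shortest₁ e , rainbow₁ e) (λ _ → inj₂ (inj₁ e))
      ... | no u≁v = mk⇔ toPath (λ (p , s , r) → fromPath p s r)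
        where
        toPath : Good u v → ∃[ p ] IsShortestPath {G = G} {u} {v} p × Rainbow p
        toPath (inj₁ u≡v)        = contradiction u≡v u≢v
        toPath (inj₂ (inj₁ e))   = contradiction e u≁v
        toPath (inj₂ (inj₂ (inj₁ (w , (e , f) , d)))) =
          e ◅ f ◅ ε , shortest₂ u≢v u≁v e f , from (rainbow₂ e f) d
        toPath (inj₂ (inj₂ (inj₂ (¬j , w , x , (e , f , g) , d)))) =
          e ◅ f ◅ g ◅ ε , shortest₃ u≢v u≁v ¬j e f g , from (rainbow₃ e f g) d

        fromPath : ∀ p → IsShortestPath {G = G} {u} {v} p → Rainbow p → Good u v
        fromPath ε           _ _ = contradiction refl u≢v
        fromPath (e ◅ ε)     _ _ = contradiction e u≁v
        fromPath (e ◅ f ◅ ε) _ r = inj₂ (inj₂ (inj₁ (_ , (e , f) , to (rainbow₂ e f) r)))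
        fromPath (e ◅ f ◅ g ◅ p) (_ , _ , minimal) r with joined? u v
        -- A common neighbour gives a path of length two, too short for a shortest path with at
        -- least three edges.
        ... | yes (_ , h , i) with minimal (h ◅ i ◅ ε) (proj₁ (shortest₂ u≢v u≁v h i))
        ...   | s≤s (s≤s ())
        fromPath (e ◅ f ◅ g ◅ p) (_ , _ , minimal) r | no ¬j
          -- The path of length three through the clique serves only as a competitor: it forces the
          -- tail `p` to be empty. The colours are those of the given path.
          with _ , _ , h , i , j ← split-diameter conn split u≢v u≁v ¬j
          with p | minimal (h ◅ i ◅ j ◅ ε) (proj₁ (shortest₃ u≢v u≁v ¬j h i j))
        ... | ε     | _ = inj₂ (inj₂ (inj₂ (¬j , _ , _ , (e , f , g) , to (rainbow₃ e f g) r)))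
        ... | _ ◅ _ | s≤s (s≤s (s≤s ()))

-- Reading the input

contents-++ˡ : ∀ xs ys {i} → i < length xs → contents (xs ++ ys) i ≡ contents xs i
contents-++ˡ (x ∷ xs) ys {zero}  _         = refl
contents-++ˡ (x ∷ xs) ys {suc i} (s≤s i<l) = contents-++ˡ xs ys i<l

contents-++ʳ : ∀ xs ys {l} → length xs ≡ l → ∀ i → contents (xs ++ ys) (l + i) ≡ contents ys i
contents-++ʳ []       ys refl i = refl
contents-++ʳ (x ∷ xs) ys refl i = contents-++ʳ xs ys refl i

contents-tabulate : ∀ {n} (f : Fin n → ℕ) i → contents (tabulate f) (toℕ i) ≡ f i
contents-tabulate f zero    = refl
contents-tabulate f (suc i) = contents-tabulate (f ∘ suc) i

module _ {n : ℕ} where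

  contents-rows : ∀ {m} (F : Fin m → List ℕ) → (∀ u → length (F u) ≡ n) → ∀ ws u {i} → i < n →
    contents (concat (tabulate F) ++ ws) (n * toℕ u + i) ≡ contents (F u) i
  contents-rows F len ws zero {i} i<n = begin
    contents ((F zero ++ rest) ++ ws) (n * 0 + i)
      ≡⟨ cong₂ contents (++-assoc (F zero) rest ws) (cong (_+ i) (*-zeroʳ n)) ⟩
    contents (F zero ++ (rest ++ ws)) i
      ≡⟨ contents-++ˡ (F zero) (rest ++ ws) (subst (i <_) (sym (len zero)) i<n) ⟩
    contents (F zero) i ∎
    where
    open ≡-Reasoning
    rest = concat (tabulate (F ∘ suc))
  contents-rows F len ws (suc u) {i} i<n = begin
    contents ((F zero ++ rest) ++ ws) (n * suc (toℕ u) + i)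
      ≡⟨ cong₂ contents (++-assoc (F zero) rest ws)
           (trans (cong (_+ i) (*-suc n (toℕ u))) (+-assoc n (n * toℕ u) i)) ⟩
    contents (F zero ++ (rest ++ ws)) (n + (n * toℕ u + i))
      ≡⟨ contents-++ʳ (F zero) (rest ++ ws) (len zero) (n * toℕ u + i) ⟩
    contents (rest ++ ws) (n * toℕ u + i)
      ≡⟨ contents-rows (F ∘ suc) (len ∘ suc) ws u i<n ⟩
    contents (F (suc u)) i ∎
    where
    open ≡-Reasoning
    rest = concat (tabulate (F ∘ suc))

  length-rows : ∀ {m} (F : Fin m → List ℕ) → (∀ u → length (F u) ≡ n) →
                length (concat (tabulate F)) ≡ m * n
  length-rows {zero}  F len = refl
  length-rows {suc m} F len = trans (length-++ (F zero))
    (cong₂ _+_ (len zero) (length-rows (F ∘ suc) (len ∘ suc)))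

  contents-matrix : ∀ (f : Fin n → Fin n → ℕ) ws u v →
    contents (matrix f ++ ws) (n * toℕ u + toℕ v) ≡ f u v
  contents-matrix f ws u v = trans
    (contents-rows (λ u → tabulate (f u)) (λ u → length-tabulate (f u)) ws u (toℕ<n v))
    (contents-tabulate (f u) v)

  length-matrix : ∀ (f : Fin n → Fin n → ℕ) → length (matrix f) ≡ n * n
  length-matrix f = length-rows (λ u → tabulate (f u)) (λ u → length-tabulate (f u))

length≤size : ∀ ws → length ws ≤ size ws
length≤size []       = z≤n
length≤size (w ∷ ws) = +-mono-≤ (s≤s z≤n) (length≤size ws)

n≤n*n : ∀ n → n ≤ n * n
n≤n*n zero    = z≤n
n≤n*n (suc n) = m≤m*n (suc n) (suc n)

-- The matrix contributes `n * n` words of at least one bit each, and the word for the order makes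
-- the inequality strict.
order<size : ∀ {n} (G : Graph n) ws → n < size (encodeGraph G ++ ws)
order<size {n} G ws = begin
  suc n                                  ≤⟨ s≤s (n≤n*n n) ⟩
  suc (n * n)                            ≡⟨ cong suc (length-matrix entry) ⟨
  length (encodeGraph G)                 ≤⟨ m≤m+n _ (length ws) ⟩
  length (encodeGraph G) + length ws     ≡⟨ length-++ (encodeGraph G) ⟨
  length (encodeGraph G ++ ws)           ≤⟨ length≤size (encodeGraph G ++ ws) ⟩
  size (encodeGraph G ++ ws)             ∎
  where
  open ≤-Reasoning
  entry = λ u v → if Graph.adj G u v then 1 else 0

-- The formula for rainbow shortest paths

cell : ∀ {k} → Fin k → Fin k → Exp k
-- Position in a matrix stored row by row. Adding up `x` once per vertex multiplies it by the order;
-- `suc` skips the index of that sum.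
cell x y = ∑ (var (suc x)) ⊕ var y

adjacent : ∀ {k} → Fin k → Fin k → Exp k
adjacent x y = mem (lit 1 ⊕ cell x y)

-- The word at offset e of what follows the adjacency matrix.
colourWord : ∀ {k} → Exp k → Exp k
colourWord e = mem (lit 1 ⊕ (∑ (∑ (lit 1)) ⊕ e))

-- Variables are numbered from the innermost binder: w, v, u in a formula
-- about the path u w v, and x, w, v, u in one about the path u w x v.

joined : Exp 3
joined = adjacent 2F 0F ∧ adjacent 0F 1F

joined₃ : Exp 4
joined₃ = adjacent 3F 1F ∧ adjacent 1F 0F ∧ adjacent 0F 2F

good : Exp 3 → Exp 4 → Exp 2
good d₂ d₃ =
    var 1F ≐ var 0F
  ∨ adjacent 1F 0F
  ∨ ∑ (joined ∧ d₂)
  ∨ not (∑ joined) ∧ ∑ (∑ (joined₃ ∧ d₃))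

strong : Exp 3 → Exp 4 → Exp 0
strong d₂ d₃ = all (all (good d₂ d₃))

module _ {n : ℕ} (G : Graph n) (ws : List ℕ) where
  open Graph G

  M : ℕ → ℕ
  M = contents (encodeGraph G ++ ws)

  decides-~ : ∀ u v → Decides (u ~ v) (M (1 + (∑< n (λ _ → toℕ u) + toℕ v)))
  decides-~ u v
    rewrite ∑<-const n (toℕ u)
          | contents-matrix (λ u v → if adj u v then 1 else 0) ws u v
    with adj u v
  ... | true  = holds _
  ... | false = fails λ ()

  -- The 1 skips the word for the order, and the double sum counts the `n * n` words of the
  -- adjacency matrix.
  colourWord≡ : ∀ i → M (1 + (∑< n (λ _ → ∑< n (λ _ → 1)) + i)) ≡ contents ws i
  colourWord≡ i
    rewrite ∑<-const n 1 | *-identityʳ n | ∑<-const n n =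
    contents-++ʳ (matrix entry) ws (length-matrix entry) i
    where entry = λ u v → if adj u v then 1 else 0

  module _
    {D₂ : (u w v : Fin n) → Set} {D₃ : (u w x v : Fin n) → Set} d₂ d₃
    (D₂? : ∀ u w v → Decides (D₂ u w v) (⟦ d₂ ⟧ M (toℕ w ∷ toℕ v ∷ toℕ u ∷ [])))
    (D₃? : ∀ u w x v → Decides (D₃ u w x v) (⟦ d₃ ⟧ M (toℕ x ∷ toℕ w ∷ toℕ v ∷ toℕ u ∷ [])))
    where

    decides-good : Decides (∀ u v → Good G D₂ D₃ u v) (⟦ strong d₂ d₃ ⟧ M [])
    decides-good =
      -- `M 0` reduces to `n` and the connectives unfold to the arithmetic in the types of the
      -- combinators, so the proof just follows the syntax of the formula.
      decides-∀ n (λ i → ⟦ all (good d₂ d₃) ⟧ M (i ∷ [])) λ u →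
      decides-∀ n (λ i → ⟦ good d₂ d₃ ⟧ M (i ∷ toℕ u ∷ [])) λ v →
      let ρ = toℕ v ∷ toℕ u ∷ [] in
      decides-⊎ (map-decides (mk⇔ toℕ-injective (cong toℕ)) (decides-≡ (toℕ u) (toℕ v)))
      (decides-⊎ (decides-~ u v)
      (decides-⊎
        (decides-∃ n (λ i → ⟦ joined ∧ d₂ ⟧ M (i ∷ ρ)) λ w →
          decides-× (decides-× (decides-~ u w) (decides-~ w v)) (D₂? u w v))
        (decides-×
          (decides-¬ (decides-∃ n (λ i → ⟦ joined ⟧ M (i ∷ ρ)) λ w →
            decides-× (decides-~ u w) (decides-~ w v)))
          (decides-∃ n (λ i → ⟦ ∑ (joined₃ ∧ d₃) ⟧ M (i ∷ ρ)) λ w →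
           decides-∃ n (λ i → ⟦ joined₃ ∧ d₃ ⟧ M (i ∷ toℕ w ∷ ρ)) λ x →
            decides-× (decides-× (decides-~ u w) (decides-× (decides-~ w x) (decides-~ x v)))
                      (D₃? u w x v)))))

-- The two problems

unique₂ : ∀ {a b a′ b′ : ℕ} → a ≡ a′ → b ≡ b′ → Unique (a ∷ b ∷ []) ⇔ a′ ≢ b′
unique₂ refl refl = mk⇔ (λ { ((a≢b ∷ []) ∷ _) → a≢b }) (λ a≢b → (a≢b ∷ []) ∷ [] ∷ [])

unique₃ : ∀ {a b c a′ b′ c′ : ℕ} → a ≡ a′ → b ≡ b′ → c ≡ c′ →
          Unique (a ∷ b ∷ c ∷ []) ⇔ (a′ ≢ b′ × a′ ≢ c′ × b′ ≢ c′)
unique₃ refl refl refl = mk⇔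
  (λ { ((a≢b ∷ a≢c ∷ []) ∷ (b≢c ∷ []) ∷ _) → a≢b , a≢c , b≢c })
  (λ (a≢b , a≢c , b≢c) → (a≢b ∷ a≢c ∷ []) ∷ (b≢c ∷ []) ∷ [] ∷ [])

all-pairs : ∀ {A : Set} {P Q : A → A → Set} → (∀ u v → P u v ⇔ Q u v) →
            (∀ u v → P u v) ⇔ (∀ u v → Q u v)
all-pairs P⇔Q = mk⇔ (λ p u v → Equivalence.to (P⇔Q u v) (p u v))
                    (λ q u v → Equivalence.from (P⇔Q u v) (q u v))

edgeWord : ∀ {k} → Fin k → Fin k → Exp k
edgeWord x y = colourWord (cell x y)

edges₂ : Exp 3
edges₂ = edgeWord 2F 0F ≠ edgeWord 0F 1F

edges₃ : Exp 4
edges₃ =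
    edgeWord 3F 1F ≠ edgeWord 1F 0F
  ∧ edgeWord 3F 1F ≠ edgeWord 0F 2F
  ∧ edgeWord 1F 0F ≠ edgeWord 0F 2F

internal₃ : Exp 4
internal₃ = colourWord (var 1F) ≠ colourWord (var 0F)

module _ {n : ℕ} {G : Graph n} (ζ : EdgeColouring G ℕ) where
  open Graph G
  open EdgeColouring ζ

  private
    ws = encodeEdgeColouring ζ

    word : Fin n → Fin n → ℕ
    word u v = contents ws (n * toℕ u + toℕ v)

    -- The function tabulated by `encodeEdgeColouring` is local to that definition; unification
    -- recovers it.
    entries : Σ (Fin n → Fin n → ℕ) λ f → encodeEdgeColouring ζ ≡ matrix f
    entries = _ , refl

    entry≡colour : ∀ {u v} (e : u ~ v) → proj₁ entries u v ≡ colour u v e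
    entry≡colour {u} {v} e with T? (adj u v)
    ... | yes e′ = cong (colour u v) (T-irrelevant e′ e)
    ... | no ¬e  = contradiction e ¬e

  colour≡word : ∀ {u v} (e : u ~ v) → colour u v e ≡ word u v
  colour≡word {u} {v} e = sym (begin
    contents ws (n * toℕ u + toℕ v)         ≡⟨ cong (λ ws → contents ws _) (++-identityʳ ws) ⟨
    contents (ws ++ []) (n * toℕ u + toℕ v) ≡⟨ contents-matrix (proj₁ entries) [] u v ⟩
    proj₁ entries u v                       ≡⟨ entry≡colour e ⟩
    colour u v e                            ∎)
    where open ≡-Reasoning

  edgeWord≡ : ∀ u v →
    M G ws (1 + (∑< n (λ _ → ∑< n (λ _ → 1)) + (∑< n (λ _ → toℕ u) + toℕ v))) ≡ word u v
  edgeWord≡ u v = trans (colourWord≡ G ws _)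
    (cong (λ m → contents ws (m + toℕ v)) (∑<-const n (toℕ u)))

  -- Evaluation looks up only the variables that occur, so this one environment computes to the same
  -- number as every comparison in `edges₂` and `edges₃`, whatever their numbering.
  decides-≢-words : ∀ u v u′ v′ → Decides (word u v ≢ word u′ v′)
    (⟦ edgeWord 3F 2F ≠ edgeWord 1F 0F ⟧ (M G ws) (toℕ v′ ∷ toℕ u′ ∷ toℕ v ∷ toℕ u ∷ []))
  decides-≢-words u v u′ v′
    rewrite edgeWord≡ u v | edgeWord≡ u′ v′ = decides-≢ (word u v) (word u′ v′)

  decides-strongly-rainbow : Connected G → IsSplit G →
    Decides (IsStronglyRainbowConnected ζ) (⟦ strong edges₂ edges₃ ⟧ (M G ws) [])
  decides-strongly-rainbow conn split = map-decides
    (all-pairs (good⇔rainbow G _ _ conn split (λ p → Unique (edgeColours ζ p)) []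
      (λ _ → [] ∷ [])
      (λ e f → unique₂ (colour≡word e) (colour≡word f))
      (λ e f g → unique₃ (colour≡word e) (colour≡word f) (colour≡word g))))
    (decides-good G ws edges₂ edges₃
      (λ u w v → decides-≢-words u w w v)
      (λ u w x v → decides-× (decides-≢-words u w w x)
        (decides-× (decides-≢-words u w x v) (decides-≢-words w x x v))))

module _ {n : ℕ} {G : Graph n} (ψ : VertexColouring G ℕ) where

  decides-vertex-colour : ∀ u v → Decides (ψ u ≢ ψ v)
    (⟦ colourWord (var 1F) ≠ colourWord (var 0F) ⟧ (M G (tabulate ψ)) (toℕ v ∷ toℕ u ∷ []))
  decides-vertex-colour u v
    rewrite colourWord≡ G (tabulate ψ) (toℕ u) | colourWord≡ G (tabulate ψ) (toℕ v)
          | contents-tabulate ψ u | contents-tabulate ψ v = decides-≢ (ψ u) (ψ v)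

  -- A path of length two has one internal vertex and hence no colours to compare, which is why its
  -- condition is `lit 1`; length three leaves the single pair `w`, `x`.
  decides-strongly-rainbow-vertex : Connected G → IsSplit G →
    Decides (IsStronglyRainbowVertexConnected {G = G} ψ)
            (⟦ strong (lit 1) internal₃ ⟧ (M G (tabulate ψ)) [])
  decides-strongly-rainbow-vertex conn split = map-decides
    (all-pairs (good⇔rainbow G _ _ conn split
      (λ p → Unique (map ψ (internalVertices {G = G} p))) []
      (λ _ → [])
      (λ _ _ → mk⇔ (λ _ → tt) (λ _ → [] ∷ []))
      (λ _ _ _ → unique₂ refl refl)))
    (decides-good G (tabulate ψ) {D₂ = λ _ _ _ → ⊤} (lit 1) internal₃
      (λ _ _ _ → holds tt)
      (λ u w x v → decides-vertex-colour w x))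

corollary18 : SolvableInPolynomialTime
    (StrongRainbowConnectivity restrictedTo λ I → IsSplit (EdgeColouredInstance.graph I))
    × SolvableInPolynomialTime
    (StrongRainbowVertexConnectivity restrictedTo λ I → IsSplit (VertexColouredInstance.graph I))
corollary18 =
  solvable-by-expression _ (strong edges₂ edges₃)
    (λ (I , _) → let open EdgeColouredInstance I in
      order<size graph (encodeEdgeColouring colouring))
    (λ (I , split) → let open EdgeColouredInstance I in
      decides-strongly-rainbow colouring connected split) ,
  solvable-by-expression _ (strong (lit 1) internal₃)
    (λ (I , _) → let open VertexColouredInstance I in
      order<size graph (tabulate colouring))
    (λ (I , split) → let open VertexColouredInstance I in
      decides-strongly-rainbow-vertex colouring connected split)
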